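{- Every polynomial in $\mathcal{LP}_{4,4}$ belongs to the same isotopism class; that is, any two polynomials in $\mathcal{LP}_{4,4}$ are isotopic.
   Context: $\mathbb{F}_4$ is the field with four elements. $\mathcal{P}_4$ is the set of polynomials in $\mathbb{F}_4[x]$ of degree less than $4$ that act as permutations of $\mathbb{F}_4$. $\mathcal{LP}_4$ is the set of polynomials $f\in\mathbb{F}_4[x,y]$ of degree less than $4$ in each variable such that, for every $a\in\mathbb{F}_4$, both $f(x,a)$ and $f(a,x)$ act as permutations of $\mathbb{F}_4$. $\mathcal{LP}_{4,4}$ is the subset of polynomials of total degree $4$ in $\mathcal{LP}_4$. A polynomial $f\in\mathcal{LP}_4$ is isotopic to $g\in\mathcal{LP}_4$ if $g(h_1(x),h_2(y))=h_3(f(x,y))$ for some $h_1,h_2,h_3\in\mathcal{P}_4$, compositions being taken modulo $x^4-x$ and $y^4-y$; this is an equivalence relation, whose classes are called isotopism classes. -}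

module Defs where

open import Algebra.Apartness.Structures using (IsHeytingField)
open import Algebra.Bundles using (RawSemiring)
import Algebra.Definitions.RawSemiring as RawSemiringDefs
open import Algebra.Structures using (IsCommutativeRing)
open import Data.Bool.Base using (if_then_else_; _∧_)
open import Data.Fin.Base using (Fin; zero; suc; toℕ)
open import Data.Fin.Properties using () renaming (_≟_ to _≟ᶠ_)
open import Data.Nat.Base as ℕ using (ℕ; zero; suc)
open import Data.Nat.DivMod using (_mod_)
open import Data.Product.Base using (∃-syntax; _×_; _,_)
open import Data.Vec.Base using (Vec; lookup; tabulate)
open import Function.Definitions using (Bijective)
open import Level using (0ℓ)
open import Relation.Binary.Definitions using (DecidableEquality)
open import Relation.Binary.PropositionalEquality
  using (_≡_; _≢_; refl; cong₂; isEquivalence; decSetoid)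
open import Relation.Nullary.Decidable
  using (Dec; yes; no; does; map′; _×-dec_; _→-dec_; ¬?; from-yes)
open import Relation.Unary using (Pred; Decidable)
import Relation.Binary.Properties.DecSetoid as DecSetoidProperties

-- 𝔽₄ = 𝔽₂[ω]/(ω² + ω + 1), where ω² = ω + 1.

data 𝔽₄ : Set where
  𝟘 𝟙 ω ω² : 𝔽₄

infixl 6 _+_
infixl 7 _*_

_+_ : 𝔽₄ → 𝔽₄ → 𝔽₄
𝟘  + b  = b
𝟙  + 𝟘  = 𝟙
𝟙  + 𝟙  = 𝟘
𝟙  + ω  = ω²
𝟙  + ω² = ω
ω  + 𝟘  = ω
ω  + 𝟙  = ω²
ω  + ω  = 𝟘
ω  + ω² = 𝟙
ω² + 𝟘  = ω²
ω² + 𝟙  = ω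
ω² + ω  = 𝟙
ω² + ω² = 𝟘

_*_ : 𝔽₄ → 𝔽₄ → 𝔽₄
𝟘  * b  = 𝟘
𝟙  * b  = b
ω  * 𝟘  = 𝟘
ω  * 𝟙  = ω
ω  * ω  = ω²
ω  * ω² = 𝟙
ω² * 𝟘  = 𝟘
ω² * 𝟙  = ω²
ω² * ω  = 𝟙
ω² * ω² = ω

-- Characteristic 2.
-_ : 𝔽₄ → 𝔽₄
- a = a

infix 4 _≟_
_≟_ : DecidableEquality 𝔽₄
𝟘  ≟ 𝟘  = yes refl
𝟘  ≟ 𝟙  = no λ ()
𝟘  ≟ ω  = no λ ()
𝟘  ≟ ω² = no λ ()
𝟙  ≟ 𝟘  = no λ ()
𝟙  ≟ 𝟙  = yes refl
𝟙  ≟ ω  = no λ ()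
𝟙  ≟ ω² = no λ ()
ω  ≟ 𝟘  = no λ ()
ω  ≟ 𝟙  = no λ ()
ω  ≟ ω  = yes refl
ω  ≟ ω² = no λ ()
ω² ≟ 𝟘  = no λ ()
ω² ≟ 𝟙  = no λ ()
ω² ≟ ω  = no λ ()
ω² ≟ ω² = yes refl

all? : {P : Pred 𝔽₄ 0ℓ} → Decidable P → Dec (∀ a → P a)
all? P? = map′
  (λ { (p , q , r , s) → λ { 𝟘 → p ; 𝟙 → q ; ω → r ; ω² → s } })
  (λ h → h 𝟘 , h 𝟙 , h ω , h ω²)
  (P? 𝟘 ×-dec P? 𝟙 ×-dec P? ω ×-dec P? ω²)

+-*-isCommutativeRing : IsCommutativeRing _≡_ _+_ _*_ -_ 𝟘 𝟙
+-*-isCommutativeRing = record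
  { isRing = record
    { +-isAbelianGroup = record
      { isGroup = record
        { isMonoid = record
          { isSemigroup = record
            { isMagma = record { isEquivalence = isEquivalence ; ∙-cong = cong₂ _+_ }
            ; assoc = from-yes (all? λ a → all? λ b → all? λ c → (a + b) + c ≟ a + (b + c))
            }
          ; identity = from-yes (all? λ a → 𝟘 + a ≟ a)
                     , from-yes (all? λ a → a + 𝟘 ≟ a)
          }
        ; inverse = from-yes (all? λ a → - a + a ≟ 𝟘)
                  , from-yes (all? λ a → a + - a ≟ 𝟘)
        ; ⁻¹-cong = λ { refl → refl }
        }
      ; comm = from-yes (all? λ a → all? λ b → a + b ≟ b + a)
      }
    ; *-cong = cong₂ _*_
    ; *-assoc = from-yes (all? λ a → all? λ b → all? λ c → (a * b) * c ≟ a * (b * c))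
    ; *-identity = from-yes (all? λ a → 𝟙 * a ≟ a)
                 , from-yes (all? λ a → a * 𝟙 ≟ a)
    ; distrib = from-yes (all? λ a → all? λ b → all? λ c → a * (b + c) ≟ a * b + a * c)
              , from-yes (all? λ a → all? λ b → all? λ c → (b + c) * a ≟ b * a + c * a)
    }
  ; *-comm = from-yes (all? λ a → all? λ b → a * b ≟ b * a)
  }

+-*-isHeytingField : IsHeytingField _≡_ _≢_ _+_ _*_ -_ 𝟘 𝟙
+-*-isHeytingField = record
  { isHeytingCommutativeRing = record
    { isCommutativeRing   = +-*-isCommutativeRing
    ; isApartnessRelation = ≉-isApartnessRelation
    ; #⇒invertible        = λ {a} {b} a≢b → inv (a + - b) , inverses a b a≢b
    ; invertible⇒#        = λ { {a} (c , _ , e) refl → 𝟘-not-unit a c e }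
    }
  ; tight = ≉-tight
  }
  where
  open DecSetoidProperties (decSetoid _≟_)

  inv : 𝔽₄ → 𝔽₄
  inv a = a * a

  inverses : ∀ a b → a ≢ b → (inv (a + - b) * (a + - b) ≡ 𝟙) × ((a + - b) * inv (a + - b) ≡ 𝟙)
  inverses = from-yes (all? λ a → all? λ b → ¬? (a ≟ b) →-dec
    ((inv (a + - b) * (a + - b) ≟ 𝟙) ×-dec ((a + - b) * inv (a + - b) ≟ 𝟙)))

  𝟘-not-unit : ∀ a c → (a + - a) * c ≢ 𝟙
  𝟘-not-unit = from-yes (all? λ a → all? λ c → ¬? ((a + - a) * c ≟ 𝟙))

𝔽₄-rawSemiring : RawSemiring 0ℓ 0ℓ
𝔽₄-rawSemiring = record
  { Carrier = 𝔽₄ ; _≈_ = _≡_ ; _+_ = _+_ ; _*_ = _*_ ; 0# = 𝟘 ; 1# = 𝟙 }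

-- Polynomials of degree less than 4 (in each variable), by coefficients:
-- entry i of a Poly₁ is the coefficient of xⁱ, and entry j of row i of a
-- Poly₂ is the coefficient of xⁱyʲ.

Poly₁ : Set
Poly₁ = Vec 𝔽₄ 4

Poly₂ : Set
Poly₂ = Vec (Vec 𝔽₄ 4) 4

coeff : Poly₂ → Fin 4 → Fin 4 → 𝔽₄
coeff f i j = lookup (lookup f i) j

fromCoeff : (Fin 4 → Fin 4 → 𝔽₄) → Poly₂
fromCoeff c = tabulate λ i → tabulate (c i)

-- Substitution of elements of an 𝔽₄-algebra A, with structure map ι, into a
-- polynomial.  A = 𝔽₄ gives evaluation, A = Quotient (below) composition.

module Substitution (A : RawSemiring 0ℓ 0ℓ) (ι : 𝔽₄ → RawSemiring.Carrier A) where
  open RawSemiring A using (Carrier) renaming (_*_ to _·_)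
  open RawSemiringDefs A using (sum; _^_)

  subst₁ : Poly₁ → Carrier → Carrier
  subst₁ h s = sum λ i → ι (lookup h i) · s ^ toℕ i

  subst₂ : Poly₂ → Carrier → Carrier → Carrier
  subst₂ f s t = sum λ i → sum λ j → ι (coeff f i j) · (s ^ toℕ i · t ^ toℕ j)

open Substitution 𝔽₄-rawSemiring (λ a → a) public
  using () renaming (subst₁ to eval₁; subst₂ to eval₂)

-- The quotient 𝔽₄[x,y]/(x⁴ - x, y⁴ - y).  Every class has a unique
-- representative of degree less than 4 in each variable, so Poly₂ is its
-- carrier and equality of classes is _≡_.

-- xⁿ ≡ x^(reduce n) modulo x⁴ - x: x⁰ is fixed and x^(k+1) = x^(k+4).
reduce : ℕ → Fin 4
reduce zero    = zero
reduce (suc k) = suc (k mod 3)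

const : 𝔽₄ → Poly₂
const a = fromCoeff λ { zero zero → a ; _ _ → 𝟘 }

X Y : Poly₂
X = fromCoeff λ { (suc zero) zero → 𝟙 ; _ _ → 𝟘 }
Y = fromCoeff λ { zero (suc zero) → 𝟙 ; _ _ → 𝟘 }

infixl 6 _⊕_
infixl 7 _⊗_

_⊕_ : Poly₂ → Poly₂ → Poly₂
p ⊕ q = fromCoeff λ k l → coeff p k l + coeff q k l

_⊗_ : Poly₂ → Poly₂ → Poly₂
p ⊗ q = fromCoeff λ k l →
  sum λ i → sum λ j → sum λ i′ → sum λ j′ →
    if does (reduce (toℕ i ℕ.+ toℕ i′) ≟ᶠ k) ∧ does (reduce (toℕ j ℕ.+ toℕ j′) ≟ᶠ l)
    then coeff p i j * coeff q i′ j′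
    else 𝟘
  where open RawSemiringDefs 𝔽₄-rawSemiring using (sum)

Quotient : RawSemiring 0ℓ 0ℓ
Quotient = record
  { Carrier = Poly₂ ; _≈_ = _≡_ ; _+_ = _⊕_ ; _*_ = _⊗_ ; 0# = const 𝟘 ; 1# = const 𝟙 }

open Substitution Quotient const public
  using () renaming (subst₁ to compose₁; subst₂ to compose₂)

IsPermutation : (𝔽₄ → 𝔽₄) → Set
IsPermutation = Bijective _≡_ _≡_

𝒫₄ : Pred Poly₁ 0ℓ
𝒫₄ h = IsPermutation (eval₁ h)

ℒ𝒫₄ : Pred Poly₂ 0ℓ
ℒ𝒫₄ f = ∀ a → IsPermutation (λ x → eval₂ f x a) × IsPermutation (λ x → eval₂ f a x)

HasTotalDegree : Poly₂ → ℕ → Set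
HasTotalDegree f d =
    (∃[ i ] ∃[ j ] (coeff f i j ≢ 𝟘 × toℕ i ℕ.+ toℕ j ≡ d))
  × (∀ i j → coeff f i j ≢ 𝟘 → toℕ i ℕ.+ toℕ j ℕ.≤ d)

ℒ𝒫₄,₄ : Pred Poly₂ 0ℓ
ℒ𝒫₄,₄ f = ℒ𝒫₄ f × HasTotalDegree f 4

-- g(h₁(x), h₂(y)) = h₃(f(x, y)) modulo x⁴ - x and y⁴ - y.
Isotopic : Poly₂ → Poly₂ → Set
Isotopic f g =
  ∃[ h₁ ] ∃[ h₂ ] ∃[ h₃ ] (𝒫₄ h₁ × 𝒫₄ h₂ × 𝒫₄ h₃ ×
    compose₂ g (compose₁ h₁ X) (compose₁ h₂ Y) ≡ compose₁ h₃ f)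

{-# OPTIONS --safe #-}
module Submission where

-- Evaluation embeds 𝔽₄[x,y]/(x⁴ - x, y⁴ - y) into the functions 𝔽₄ × 𝔽₄ → 𝔽₄,
-- and every function on 𝔽₄ is interpolated by a polynomial, so isotopy can be
-- tested on functions.  With e = f(0,0), the maps x ↦ e + f(x,0), y ↦ e + f(0,y)
-- and z ↦ e + z carry a Latin square f to a loop with identity 0, and the only
-- such loops are a + b + u² tr(ua) tr(ub) for u ∈ 𝔽₄.  If u = 0, then
-- f(x,y) = f(x,0) + f(0,y) + e, which has no mixed monomial and hence cannot have
-- total degree 4.  If u ≠ 0, then u³ = 1, and multiplication by u carries the
-- loop to the one with u = 1.

open import Algebra.Bundles using (CommutativeRing)
import Algebra.Definitions.RawSemiring as RawSemiringDefs
import Algebra.Properties.CommutativeSemigroup as CommutativeSemigroupProperties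
import Algebra.Properties.Group as GroupProperties
import Algebra.Properties.Semiring.Sum as SemiringSum
open import Data.Bool.Base using (Bool; true; false; if_then_else_; _∧_)
open import Data.Empty using (⊥-elim)
open import Data.Fin.Base using (Fin; zero; suc; toℕ)
open import Data.Fin.Properties using (toℕ<n) renaming (_≟_ to _≟ᶠ_; all? to allFin?)
open import Data.Nat.Base as ℕ using (zero; suc)
open import Data.Nat.Properties as ℕ using (<⇒≢)
open import Data.Product.Base using (∃-syntax; _×_; _,_; proj₁; proj₂)
open import Data.Sum.Base using (_⊎_; inj₁; inj₂; [_,_]′)
open import Data.Vec.Base using (Vec; []; _∷_; lookup; tabulate; map; replicate)
open import Data.Vec.Properties using (lookup∘tabulate; lookup-map; lookup-replicate; tabulate∘lookup; tabulate-cong; ≡-dec)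
open import Function.Base using (_∘_; id)
open import Function.Bundles using (_↔_; mk⤖; mk↔ₛ′; module Inverse)
open import Function.Properties.Bijection using (⤖⇒↔)
open import Function.Properties.Inverse using (↔-sym; ↔-trans)
open import Level using (0ℓ)
open import Relation.Binary.PropositionalEquality
open import Relation.Nullary.Decidable using (Dec; yes; no; does; map′; _×-dec_; _→-dec_; ¬?; from-yes)
open import Relation.Nullary.Negation using (¬_)
open import Relation.Unary using (Pred; Decidable)

open import Defs

-- The ring 𝔽₄ and its finite sums.

𝔽₄-commutativeRing : CommutativeRing 0ℓ 0ℓ
𝔽₄-commutativeRing = record { isCommutativeRing = +-*-isCommutativeRing }

open CommutativeRing 𝔽₄-commutativeRing
  using ( semiring; +-group; +-assoc; +-identityʳ; -‿inverseʳ; *-identityʳ; distribʳ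
        ; +-commutativeSemigroup; *-commutativeSemigroup )
open SemiringSum semiring using (sum; sum-cong-≗; ∑-distrib-+; ∑-comm; *-distribˡ-sum; *-distribʳ-sum; sum-replicate-zero)
open CommutativeSemigroupProperties *-commutativeSemigroup using (interchange; xy∙z≈x∙zy)
open CommutativeSemigroupProperties +-commutativeSemigroup using (xy∙z≈xz∙y)
open RawSemiringDefs 𝔽₄-rawSemiring using (_^_)
private module Q = RawSemiringDefs Quotient
open GroupProperties +-group using () renaming (∙-cancelˡ to +-cancelˡ)

-- Summation over pairs of indices.

sum₂ : (Fin 4 → Fin 4 → 𝔽₄) → 𝔽₄
sum₂ c = sum λ i → sum (c i)

sum₂-cong : ∀ {c d} → (∀ i j → c i j ≡ d i j) → sum₂ c ≡ sum₂ d
sum₂-cong c≗d = sum-cong-≗ λ i → sum-cong-≗ (c≗d i)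

sum₂-distrib-+ : ∀ c d → sum₂ (λ i j → c i j + d i j) ≡ sum₂ c + sum₂ d
sum₂-distrib-+ c d = trans (sum-cong-≗ λ i → ∑-distrib-+ (c i) (d i)) (∑-distrib-+ (sum ∘ c) (sum ∘ d))

*-distribˡ-sum₂ : ∀ x c → x * sum₂ c ≡ sum₂ (λ i j → x * c i j)
*-distribˡ-sum₂ x c = trans (*-distribˡ-sum x (sum ∘ c)) (sum-cong-≗ λ i → *-distribˡ-sum x (c i))

*-distribʳ-sum₂ : ∀ x c → sum₂ c * x ≡ sum₂ (λ i j → c i j * x)
*-distribʳ-sum₂ x c = trans (*-distribʳ-sum x (sum ∘ c)) (sum-cong-≗ λ i → *-distribʳ-sum x (c i))

sum₂-comm : ∀ (c : Fin 4 → Fin 4 → Fin 4 → Fin 4 → 𝔽₄) →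
  sum₂ (λ k l → sum₂ λ i j → c k l i j) ≡ sum₂ (λ i j → sum₂ λ k l → c k l i j)
sum₂-comm c = begin
  (sum λ k → sum λ l → sum λ i → sum λ j → c k l i j)
    ≡⟨ sum-cong-≗ (λ k → ∑-comm λ l i → sum λ j → c k l i j) ⟩
  (sum λ k → sum λ i → sum λ l → sum λ j → c k l i j)
    ≡⟨ ∑-comm (λ k i → sum λ l → sum λ j → c k l i j) ⟩
  (sum λ i → sum λ k → sum λ l → sum λ j → c k l i j)
    ≡⟨ sum-cong-≗ (λ i → sum-cong-≗ λ k → ∑-comm λ l j → c k l i j) ⟩
  (sum λ i → sum λ k → sum λ j → sum λ l → c k l i j)
    ≡⟨ sum-cong-≗ (λ i → ∑-comm λ k j → sum λ l → c k l i j) ⟩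
  (sum λ i → sum λ j → sum λ k → sum λ l → c k l i j) ∎
  where open ≡-Reasoning

sum₂-*-sum₂ : ∀ c d →
  sum₂ c * sum₂ d ≡ sum₂ (λ i j → sum₂ λ i′ j′ → c i j * d i′ j′)
sum₂-*-sum₂ c d = trans (*-distribʳ-sum₂ (sum₂ d) c) (sum₂-cong λ i j → *-distribˡ-sum₂ (c i j) d)

sum-select : ∀ {n} (r : Fin n) (w : Fin n → 𝔽₄) →
  (sum λ k → if does (r ≟ᶠ k) then w k else 𝟘) ≡ w r
sum-select {suc n} zero    w = trans (cong (w zero +_) (sum-replicate-zero n)) (+-identityʳ (w zero))
sum-select {suc n} (suc r) w = sum-select r (w ∘ suc)

-- This disposes of the conditional in `_⊗_`: a product of two monomials contributes to the
-- coefficient at a single position `(r , s)`.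
sum₂-select : ∀ r s c (w : Fin 4 → Fin 4 → 𝔽₄) →
  sum₂ (λ k l → (if does (r ≟ᶠ k) ∧ does (s ≟ᶠ l) then c else 𝟘) * w k l) ≡ c * w r s
sum₂-select r s c w = begin
  sum₂ (λ k l → (if does (r ≟ᶠ k) ∧ does (s ≟ᶠ l) then c else 𝟘) * w k l)
    ≡⟨ sum-cong-≗ (λ k → row (does (r ≟ᶠ k)) k) ⟩
  (sum λ k → if does (r ≟ᶠ k) then c * w k s else 𝟘)
    ≡⟨ sum-select r (λ k → c * w k s) ⟩
  c * w r s ∎
  where
  open ≡-Reasoning
  -- The index tests are generalised to a Boolean, so that splitting on it reduces the conditional.
  entry : ∀ (d : Bool) k l → (if d then c else 𝟘) * w k l ≡ (if d then c * w k l else 𝟘)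
  entry false k l = refl
  entry true  k l = refl

  row : ∀ (d : Bool) k →
    (sum λ l → (if d ∧ does (s ≟ᶠ l) then c else 𝟘) * w k l) ≡ (if d then c * w k s else 𝟘)
  row false k = refl
  row true  k = trans (sum-cong-≗ λ l → entry (does (s ≟ᶠ l)) k l) (sum-select s (λ l → c * w k l))

-- Evaluation as a homomorphism on the quotient.

coeff-fromCoeff : ∀ c i j → coeff (fromCoeff c) i j ≡ c i j
coeff-fromCoeff c i j =
  trans (cong (λ row → lookup row j) (lookup∘tabulate (λ i → tabulate (c i)) i)) (lookup∘tabulate (c i) j)

-- In 𝔽₄ one has a⁴ = a, so positive exponents matter only modulo 3. The exponent 0 stays apart from
-- 3, because 0⁰ = 1 and 0³ = 0.
^-reduce : ∀ a (i i′ : Fin 4) → a ^ toℕ (reduce (toℕ i ℕ.+ toℕ i′)) ≡ a ^ toℕ i * a ^ toℕ i′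
^-reduce = from-yes (all? λ a → allFin? λ (i : Fin 4) → allFin? λ (i′ : Fin 4) →
  a ^ toℕ (reduce (toℕ i ℕ.+ toℕ i′)) ≟ a ^ toℕ i * a ^ toℕ i′)

module _ (a b : 𝔽₄) where
  open ≡-Reasoning

  private
    eval : Poly₂ → 𝔽₄
    eval p = eval₂ p a b

    monomial : Fin 4 → Fin 4 → 𝔽₄
    monomial i j = a ^ toℕ i * b ^ toℕ j

  eval-fromCoeff : ∀ c → eval (fromCoeff c) ≡ sum₂ (λ i j → c i j * monomial i j)
  eval-fromCoeff c = sum₂-cong λ i j → cong (_* monomial i j) (coeff-fromCoeff c i j)

  eval-⊕ : ∀ p q → eval (p ⊕ q) ≡ eval p + eval q
  eval-⊕ p q = begin
    eval (p ⊕ q)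
      ≡⟨ eval-fromCoeff (λ i j → coeff p i j + coeff q i j) ⟩
    sum₂ (λ i j → (coeff p i j + coeff q i j) * monomial i j)
      ≡⟨ sum₂-cong (λ i j → distribʳ (monomial i j) (coeff p i j) (coeff q i j)) ⟩
    sum₂ (λ i j → coeff p i j * monomial i j + coeff q i j * monomial i j)
      ≡⟨ sum₂-distrib-+ (λ i j → coeff p i j * monomial i j) (λ i j → coeff q i j * monomial i j) ⟩
    eval p + eval q ∎

  monomial-reduce : ∀ i j i′ j′ →
    monomial (reduce (toℕ i ℕ.+ toℕ i′)) (reduce (toℕ j ℕ.+ toℕ j′)) ≡ monomial i j * monomial i′ j′
  monomial-reduce i j i′ j′ = trans
    (cong₂ _*_ (^-reduce a i i′) (^-reduce b j j′))
    (interchange (a ^ toℕ i) (a ^ toℕ i′) (b ^ toℕ j) (b ^ toℕ j′))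

  -- Once the sum over the target position `(k , l)` is moved innermost, each pair of monomials
  -- selects one position, and there reduction of exponents does not change the value.
  eval-⊗ : ∀ p q → eval (p ⊗ q) ≡ eval p * eval q
  eval-⊗ p q = begin
    eval (p ⊗ q)
      ≡⟨ eval-fromCoeff (λ k l → sum₂ λ i j → sum₂ λ i′ j′ → term k l i j i′ j′) ⟩
    sum₂ (λ k l → sum₂ (λ i j → sum₂ λ i′ j′ → term k l i j i′ j′) * monomial k l)
      ≡⟨ sum₂-cong (λ k l → trans
           (*-distribʳ-sum₂ (monomial k l) (λ i j → sum₂ λ i′ j′ → term k l i j i′ j′))
           (sum₂-cong λ i j → *-distribʳ-sum₂ (monomial k l) (term k l i j))) ⟩
    sum₂ (λ k l → sum₂ λ i j → sum₂ λ i′ j′ → term k l i j i′ j′ * monomial k l)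
      ≡⟨ sum₂-comm (λ k l i j → sum₂ λ i′ j′ → term k l i j i′ j′ * monomial k l) ⟩
    sum₂ (λ i j → sum₂ λ k l → sum₂ λ i′ j′ → term k l i j i′ j′ * monomial k l)
      ≡⟨ sum₂-cong (λ i j → sum₂-comm λ k l i′ j′ → term k l i j i′ j′ * monomial k l) ⟩
    sum₂ (λ i j → sum₂ λ i′ j′ → sum₂ λ k l → term k l i j i′ j′ * monomial k l)
      ≡⟨ sum₂-cong (λ i j → sum₂-cong λ i′ j′ → collect i j i′ j′) ⟩
    sum₂ (λ i j → sum₂ λ i′ j′ →
      (coeff p i j * monomial i j) * (coeff q i′ j′ * monomial i′ j′))
      ≡⟨ sum₂-*-sum₂ (λ i j → coeff p i j * monomial i j) (λ i j → coeff q i j * monomial i j) ⟨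
    eval p * eval q ∎
    where
    term : (k l i j i′ j′ : Fin 4) → 𝔽₄
    term k l i j i′ j′ =
      if does (reduce (toℕ i ℕ.+ toℕ i′) ≟ᶠ k) ∧ does (reduce (toℕ j ℕ.+ toℕ j′) ≟ᶠ l)
      then coeff p i j * coeff q i′ j′
      else 𝟘

    collect : ∀ i j i′ j′ → sum₂ (λ k l → term k l i j i′ j′ * monomial k l)
      ≡ (coeff p i j * monomial i j) * (coeff q i′ j′ * monomial i′ j′)
    collect i j i′ j′ = begin
      sum₂ (λ k l → term k l i j i′ j′ * monomial k l)
        ≡⟨ sum₂-select (reduce (toℕ i ℕ.+ toℕ i′)) (reduce (toℕ j ℕ.+ toℕ j′)) _ monomial ⟩
      (coeff p i j * coeff q i′ j′) * monomial (reduce (toℕ i ℕ.+ toℕ i′)) (reduce (toℕ j ℕ.+ toℕ j′))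
        ≡⟨ cong ((coeff p i j * coeff q i′ j′) *_) (monomial-reduce i j i′ j′) ⟩
      (coeff p i j * coeff q i′ j′) * (monomial i j * monomial i′ j′)
        ≡⟨ interchange (coeff p i j) (coeff q i′ j′) (monomial i j) (monomial i′ j′) ⟩
      (coeff p i j * monomial i j) * (coeff q i′ j′ * monomial i′ j′) ∎

  eval-const : ∀ c → eval (const c) ≡ c
  eval-const = const-value a b
    where
    -- The point is quantified again, since enumeration decides only closed statements and `a`, `b`
    -- are fixed in this module.
    const-value : ∀ a b c → eval₂ (const c) a b ≡ c
    const-value = from-yes (all? λ a → all? λ b → all? λ c → eval₂ (const c) a b ≟ c)

  eval-X : eval X ≡ a
  eval-X = X-value a b
    where
    X-value : ∀ a b → eval₂ X a b ≡ a
    X-value = from-yes (all? λ a → all? λ b → eval₂ X a b ≟ a)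

  eval-Y : eval Y ≡ b
  eval-Y = Y-value a b
    where
    Y-value : ∀ a b → eval₂ Y a b ≡ b
    Y-value = from-yes (all? λ a → all? λ b → eval₂ Y a b ≟ b)

  eval-sum : ∀ {n} (v : Fin n → Poly₂) → eval (Q.sum v) ≡ sum (eval ∘ v)
  eval-sum {zero}  v = eval-const 𝟘
  eval-sum {suc n} v = trans (eval-⊕ (v zero) (Q.sum (v ∘ suc))) (cong (eval (v zero) +_) (eval-sum (v ∘ suc)))

  eval-^ : ∀ s n → eval (s Q.^ n) ≡ eval s ^ n
  eval-^ s zero    = eval-const 𝟙
  eval-^ s (suc n) = trans (eval-⊗ s (s Q.^ n)) (cong (eval s *_) (eval-^ s n))

  eval-compose₁ : ∀ h s → eval (compose₁ h s) ≡ eval₁ h (eval s)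
  eval-compose₁ h s = trans (eval-sum λ i → const (lookup h i) ⊗ s Q.^ toℕ i) (sum-cong-≗ λ i →
    trans (eval-⊗ (const (lookup h i)) (s Q.^ toℕ i)) (cong₂ _*_ (eval-const (lookup h i)) (eval-^ s (toℕ i))))

  eval-compose₂ : ∀ f s t → eval (compose₂ f s t) ≡ eval₂ f (eval s) (eval t)
  eval-compose₂ f s t = trans (eval-sum λ i → Q.sum (summand i)) (sum-cong-≗ λ i →
    trans (eval-sum (summand i)) (sum-cong-≗ (eval-summand i)))
    where
    summand : Fin 4 → Fin 4 → Poly₂
    summand i j = const (coeff f i j) ⊗ (s Q.^ toℕ i ⊗ t Q.^ toℕ j)

    eval-summand : ∀ i j → eval (summand i j) ≡ coeff f i j * (eval s ^ toℕ i * eval t ^ toℕ j)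
    eval-summand i j = trans
      (eval-⊗ (const (coeff f i j)) (s Q.^ toℕ i ⊗ t Q.^ toℕ j))
      (cong₂ _*_ (eval-const (coeff f i j))
        (trans (eval-⊗ (s Q.^ toℕ i) (t Q.^ toℕ j)) (cong₂ _*_ (eval-^ s (toℕ i)) (eval-^ t (toℕ j)))))

-- Interpolation.

-- For i ≥ 1 the coefficient of xⁱ is ∑ h(a) a³⁻ⁱ, since ∑ aᵏ over a ∈ 𝔽₄ is 1 if
-- k is a positive multiple of 3 and 0 otherwise.
lagrange : 𝔽₄ → 𝔽₄ → 𝔽₄ → 𝔽₄ → Poly₁
lagrange w x y z = w ∷ x + ω² * y + ω * z ∷ x + ω * y + ω² * z ∷ w + x + y + z ∷ []

interpolate : (𝔽₄ → 𝔽₄) → Poly₁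
interpolate h = lagrange (h 𝟘) (h 𝟙) (h ω) (h ω²)

interpolate-cong : ∀ {g h} → g ≗ h → interpolate g ≡ interpolate h
interpolate-cong {g} g≗h rewrite g≗h 𝟘 | g≗h 𝟙 | g≗h ω | g≗h ω² = refl

-- Functions on 𝔽₄ are given by four values so that they can be enumerated.
fromValues : 𝔽₄ → 𝔽₄ → 𝔽₄ → 𝔽₄ → 𝔽₄ → 𝔽₄
fromValues w x y z 𝟘  = w
fromValues w x y z 𝟙  = x
fromValues w x y z ω  = y
fromValues w x y z ω² = z

fromValues-values : ∀ h → fromValues (h 𝟘) (h 𝟙) (h ω) (h ω²) ≗ h
fromValues-values h 𝟘  = refl
fromValues-values h 𝟙  = refl
fromValues-values h ω  = refl
fromValues-values h ω² = refl

eval-lagrange : ∀ w x y z → eval₁ (lagrange w x y z) ≗ fromValues w x y z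
eval-lagrange = from-yes (all? λ w → all? λ x → all? λ y → all? λ z → all? λ a →
  eval₁ (lagrange w x y z) a ≟ fromValues w x y z a)

eval-interpolate : ∀ h → eval₁ (interpolate h) ≗ h
eval-interpolate h a = trans (eval-lagrange (h 𝟘) (h 𝟙) (h ω) (h ω²) a) (fromValues-values h a)

allVec? : ∀ {n} {P : Pred (Vec 𝔽₄ n) 0ℓ} → Decidable P → Dec (∀ p → P p)
allVec? {zero}  P? = map′ (λ { P[] [] → P[] }) (λ ∀P → ∀P []) (P? [])
allVec? {suc n} P? = map′ (λ { ∀P (c ∷ p) → ∀P c p }) (λ ∀P c p → ∀P (c ∷ p))
  (all? λ c → allVec? λ p → P? (c ∷ p))

-- Checked on all 256 polynomials. This left inverse is what makes a polynomial determined by its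
-- values.
interpolate-eval : ∀ p → interpolate (eval₁ p) ≡ p
interpolate-eval = from-yes (allVec? λ p → ≡-dec _≟_ (interpolate (eval₁ p)) p)

eval₁-injective : ∀ p q → eval₁ p ≗ eval₁ q → p ≡ q
eval₁-injective p q p≗q = begin
  p                      ≡⟨ interpolate-eval p ⟨
  interpolate (eval₁ p)  ≡⟨ interpolate-cong p≗q ⟩
  interpolate (eval₁ q)  ≡⟨ interpolate-eval q ⟩
  q                      ∎
  where open ≡-Reasoning

-- Adding `k` to the constant coefficient of `q` gives a polynomial with the values of `p`, hence
-- `p` itself; the other coefficients are untouched.
eval₁-translate : ∀ p q k → (∀ a → eval₁ p a ≡ eval₁ q a + k) →
  ∀ i → lookup p (suc i) ≡ lookup q (suc i)
eval₁-translate p (c ∷ q) k p≗q+k i = cong (λ r → lookup r (suc i)) (eval₁-injective p (c + k ∷ q) λ a → trans (p≗q+k a) (shift a))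
  where
  shift : ∀ a → eval₁ (c ∷ q) a + k ≡ eval₁ (c + k ∷ q) a
  shift a rewrite *-identityʳ c | *-identityʳ (c + k) = xy∙z≈xz∙y c _ k

-- The one-variable polynomial f(x, b).
rowValues : Poly₂ → 𝔽₄ → Poly₁
rowValues f b = map (λ row → eval₁ row b) f

eval₂-rowValues : ∀ f a b → eval₂ f a b ≡ eval₁ (rowValues f b) a
eval₂-rowValues f a b = sum-cong-≗ λ i → sym (begin
  lookup (rowValues f b) i * a ^ toℕ i
    ≡⟨ cong (_* a ^ toℕ i) (lookup-map i (λ row → eval₁ row b) f) ⟩
  eval₁ (lookup f i) b * a ^ toℕ i
    ≡⟨ *-distribʳ-sum (a ^ toℕ i) (λ j → coeff f i j * b ^ toℕ j) ⟩
  (sum λ j → coeff f i j * b ^ toℕ j * a ^ toℕ i)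
    ≡⟨ sum-cong-≗ (λ j → xy∙z≈x∙zy (coeff f i j) (b ^ toℕ j) (a ^ toℕ i)) ⟩
  (sum λ j → coeff f i j * (a ^ toℕ i * b ^ toℕ j)) ∎)
  where open ≡-Reasoning

-- Uniqueness in one variable is used twice: first for f(x, b) with `b` fixed, then for each
-- coefficient of xⁱ as a polynomial in y.
eval₂-injective : ∀ {f g} → (∀ a b → eval₂ f a b ≡ eval₂ g a b) → f ≡ g
eval₂-injective {f} {g} f≗g = begin
  f                    ≡⟨ tabulate∘lookup f ⟨
  tabulate (lookup f)  ≡⟨ tabulate-cong (λ i → eval₁-injective (lookup f i) (lookup g i) (row i)) ⟩
  tabulate (lookup g)  ≡⟨ tabulate∘lookup g ⟩
  g                    ∎
  where
  open ≡-Reasoning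
  rowValues-≡ : ∀ b → rowValues f b ≡ rowValues g b
  rowValues-≡ b = eval₁-injective (rowValues f b) (rowValues g b) λ a →
    trans (sym (eval₂-rowValues f a b)) (trans (f≗g a b) (eval₂-rowValues g a b))

  row : ∀ i → eval₁ (lookup f i) ≗ eval₁ (lookup g i)
  row i b = begin
    eval₁ (lookup f i) b      ≡⟨ lookup-map i _ f ⟨
    lookup (rowValues f b) i  ≡⟨ cong (λ p → lookup p i) (rowValues-≡ b) ⟩
    lookup (rowValues g b) i  ≡⟨ lookup-map i _ g ⟩
    eval₁ (lookup g i) b      ∎

-- The polynomials f(x, b) and f(x, 0) differ by a constant, so for i ≥ 1 the coefficient of xⁱ, a
-- polynomial in y, takes the same value at every `b` and has no positive power of y.
separable⇒mixed-coeff≡𝟘 : ∀ f (k : 𝔽₄ → 𝔽₄) → (∀ a b → eval₂ f a b ≡ eval₂ f a 𝟘 + k b) →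
  ∀ i j → coeff f (suc i) (suc j) ≡ 𝟘
separable⇒mixed-coeff≡𝟘 f k separable i j = trans
  -- The comparison is with the zero polynomial, whose value plus `eval₁ row 𝟘` reduces to
  -- `eval₁ row 𝟘`.
  (eval₁-translate row (replicate 4 𝟘) (eval₁ row 𝟘) row-constant j)
  (lookup-replicate j 𝟘)
  where
  open ≡-Reasoning
  row = lookup f (suc i)

  rowValues-translate : ∀ b a → eval₁ (rowValues f b) a ≡ eval₁ (rowValues f 𝟘) a + k b
  rowValues-translate b a = begin
    eval₁ (rowValues f b) a        ≡⟨ eval₂-rowValues f a b ⟨
    eval₂ f a b                    ≡⟨ separable a b ⟩
    eval₂ f a 𝟘 + k b              ≡⟨ cong (_+ k b) (eval₂-rowValues f a 𝟘) ⟩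
    eval₁ (rowValues f 𝟘) a + k b  ∎

  row-constant : ∀ b → eval₁ row b ≡ eval₁ row 𝟘
  row-constant b = begin
    eval₁ row b                     ≡⟨ lookup-map (suc i) (λ p → eval₁ p b) f ⟨
    lookup (rowValues f b) (suc i)  ≡⟨ eval₁-translate (rowValues f b) (rowValues f 𝟘) (k b) (rowValues-translate b) i ⟩
    lookup (rowValues f 𝟘) (suc i)  ≡⟨ lookup-map (suc i) (λ p → eval₁ p 𝟘) f ⟩
    eval₁ row 𝟘                     ∎

-- A power of a single variable has degree at most 3, so a monomial of total degree 4 involves both
-- variables.
totalDegree4⇒mixed : ∀ f → HasTotalDegree f 4 → ¬ (∀ i j → coeff f (suc i) (suc j) ≡ 𝟘)
totalDegree4⇒mixed f ((zero  , j     , _ , j≡4) , _) _ = <⇒≢ (toℕ<n j) j≡4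
totalDegree4⇒mixed f ((suc i , zero  , _ , i≡4) , _) _ =
  <⇒≢ (toℕ<n (suc i)) (trans (sym (ℕ.+-identityʳ (toℕ (suc i)))) i≡4)
totalDegree4⇒mixed f ((suc i , suc j , c≢𝟘 , _) , _) mixed≡𝟘 = c≢𝟘 (mixed≡𝟘 i j)

-- Isotopy of binary operations.

open Inverse using (to; from; strictlyInverseˡ; strictlyInverseʳ)

-- Bijections carry explicit inverses, so isotopisms are inverted and composed without polynomial
-- arithmetic.
record _≃_ (F G : 𝔽₄ → 𝔽₄ → 𝔽₄) : Set where
  constructor isotopy
  field
    α β γ    : 𝔽₄ ↔ 𝔽₄
    commutes : ∀ x y → G (to α x) (to β y) ≡ to γ (F x y)

≃-sym : ∀ {F G} → F ≃ G → G ≃ F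
≃-sym {F} {G} (isotopy α β γ commutes) = isotopy (↔-sym α) (↔-sym β) (↔-sym γ) λ x y → begin
  F (from α x) (from β y)                             ≡⟨ strictlyInverseʳ γ _ ⟨
  from γ (to γ (F (from α x) (from β y)))             ≡⟨ cong (from γ) (commutes (from α x) (from β y)) ⟨
  from γ (G (to α (from α x)) (to β (from β y)))      ≡⟨ cong (from γ) (cong₂ G (strictlyInverseˡ α x) (strictlyInverseˡ β y)) ⟩
  from γ (G x y)                                      ∎
  where open ≡-Reasoning

≃-trans : ∀ {F G H} → F ≃ G → G ≃ H → F ≃ H
≃-trans (isotopy α β γ commutes) (isotopy α′ β′ γ′ commutes′) =
  isotopy (↔-trans α α′) (↔-trans β β′) (↔-trans γ γ′) λ x y →
    trans (commutes′ (to α x) (to β y)) (cong (to γ′) (commutes x y))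

interpolate-𝒫₄ : ∀ (h : 𝔽₄ ↔ 𝔽₄) → 𝒫₄ (interpolate (to h))
interpolate-𝒫₄ h = injective , surjective
  where
  value = eval-interpolate (to h)

  injective : ∀ {a b} → eval₁ (interpolate (to h)) a ≡ eval₁ (interpolate (to h)) b → a ≡ b
  injective {a} {b} e = trans (sym (strictlyInverseʳ h a))
    (trans (cong (from h) (trans (sym (value a)) (trans e (value b)))) (strictlyInverseʳ h b))

  surjective : ∀ b → ∃[ a ] (∀ {c} → c ≡ a → eval₁ (interpolate (to h)) c ≡ b)
  surjective b = from h b , λ { refl → trans (value (from h b)) (strictlyInverseˡ h b) }

-- Interpolation turns the three bijections into permutation polynomials, and the identity in the
-- quotient is then checked on values.
≃⇒Isotopic : ∀ f g → eval₂ f ≃ eval₂ g → Isotopic f g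
≃⇒Isotopic f g (isotopy α β γ commutes) =
  h₁ , h₂ , h₃ , interpolate-𝒫₄ α , interpolate-𝒫₄ β , interpolate-𝒫₄ γ , eval₂-injective λ a b → begin
    eval₂ (compose₂ g (compose₁ h₁ X) (compose₁ h₂ Y)) a b
      ≡⟨ eval-compose₂ a b g (compose₁ h₁ X) (compose₁ h₂ Y) ⟩
    eval₂ g (eval₂ (compose₁ h₁ X) a b) (eval₂ (compose₁ h₂ Y) a b)
      ≡⟨ cong₂ (eval₂ g) (substitute α X a b (eval-X a b)) (substitute β Y a b (eval-Y a b)) ⟩
    eval₂ g (to α a) (to β b)
      ≡⟨ commutes a b ⟩
    to γ (eval₂ f a b)
      ≡⟨ substitute γ f a b refl ⟨
    eval₂ (compose₁ h₃ f) a b ∎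
  where
  open ≡-Reasoning
  h₁ = interpolate (to α)
  h₂ = interpolate (to β)
  h₃ = interpolate (to γ)

  substitute : ∀ h s a b {c} → eval₂ s a b ≡ c → eval₂ (compose₁ (interpolate (to h)) s) a b ≡ to h c
  substitute h s a b refl = trans (eval-compose₁ a b (interpolate (to h)) s) (eval-interpolate (to h) (eval₂ s a b))

-- Loops on 𝔽₄ with identity 𝟘.

-- The trace from 𝔽₄ to 𝔽₂.
tr : 𝔽₄ → 𝔽₄
tr a = a + a * a

-- For u = 0 this is addition. Otherwise it is a cyclic group of order 4 whose element of order 2 is
-- u² = u⁻¹.
twist : 𝔽₄ → 𝔽₄ → 𝔽₄ → 𝔽₄
twist u a b = a + b + u * u * (tr (u * a) * tr (u * b))

-- On the right the trace term has the factor u³, which is 1 for u ≠ 0; for u = 0 both sides vanish.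
twist-scale : ∀ u a b → twist 𝟙 (u * a) (u * b) ≡ u * twist u a b
twist-scale = from-yes (all? λ u → all? λ a → all? λ b →
  twist 𝟙 (u * a) (u * b) ≟ u * twist u a b)

Injective : (𝔽₄ → 𝔽₄) → Set
Injective h = ∀ a b → h a ≡ h b → a ≡ b

injective? : Decidable Injective
injective? h = all? λ a → all? λ b → (h a ≟ h b) →-dec (a ≟ b)

injective-≗ : ∀ {g h} → g ≗ h → Injective h → Injective g
injective-≗ g≗h inj a b ga≡gb = inj a b (trans (sym (g≗h a)) (trans ga≡gb (g≗h b)))

-- Since 𝔽₄ is finite, injective translations are bijective, so these are loops in the usual sense.
record IsLoop (_∙_ : 𝔽₄ → 𝔽₄ → 𝔽₄) : Set where
  field
    identityˡ  : ∀ b → 𝟘 ∙ b ≡ b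
    identityʳ  : ∀ a → a ∙ 𝟘 ≡ a
    injectiveˡ : ∀ a → Injective (a ∙_)
    injectiveʳ : ∀ b → Injective (_∙ b)

fromRows : (p q r : 𝔽₄ → 𝔽₄) → 𝔽₄ → 𝔽₄ → 𝔽₄
fromRows p q r 𝟘  b = b
fromRows p q r 𝟙  b = p b
fromRows p q r ω  b = q b
fromRows p q r ω² b = r b

-- The parameter u of a loop of the form twist u is recovered as ∑ a * (a ∙ a).
parameter : (𝔽₄ → 𝔽₄ → 𝔽₄) → 𝔽₄
parameter _∙_ = 𝟙 ∙ 𝟙 + ω * (ω ∙ ω) + ω² * (ω² ∙ ω²)

-- The entry `w` in column `𝟘` is forced by the identity law. Testing injectivity at once leaves six
-- fillings of a row before the next row is tried.
allRows? : ∀ w {P : Pred (𝔽₄ → 𝔽₄) 0ℓ} → Decidable P →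
  Dec (∀ x y z → Injective (fromValues w x y z) → P (fromValues w x y z))
allRows? w P? = all? λ x → all? λ y → all? λ z →
  injective? (fromValues w x y z) →-dec P? (fromValues w x y z)

TablesTwist : Set
TablesTwist =
  ∀ x₁ y₁ z₁ → let p = fromValues 𝟙  x₁ y₁ z₁ in Injective p →
  ∀ x₂ y₂ z₂ → let q = fromValues ω  x₂ y₂ z₂ in Injective q →
  ∀ x₃ y₃ z₃ → let r = fromValues ω² x₃ y₃ z₃ in Injective r →
  (∀ b → Injective λ a → fromRows p q r a b) →
  ∀ a b → fromRows p q r a b ≡ twist (parameter (fromRows p q r)) a b

tablesTwist? : Dec TablesTwist
tablesTwist? = allRows? 𝟙 λ p → allRows? ω λ q → allRows? ω² λ r →
  (all? λ b → injective? λ a → fromRows p q r a b) →-dec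
  (all? λ a → all? λ b → fromRows p q r a b ≟ twist (parameter (fromRows p q r)) a b)

-- Unfolding this proof, as conversion checking otherwise does, exhausts memory.
abstract
  tablesTwist : TablesTwist
  tablesTwist = from-yes tablesTwist?

-- The enumeration speaks of tables, and an operation agrees with its table only pointwise; the
-- hypotheses are carried to the table and the conclusion back.
loop-twist : ∀ {_∙_} → IsLoop _∙_ → ∃[ u ] (∀ a b → a ∙ b ≡ twist u a b)
loop-twist {_∙_} loop = parameter table , λ a b → trans (sym (table-≗ a b))
  (tablesTwist _ _ _ (row 𝟙) _ _ _ (row ω) _ _ _ (row ω²)
    (λ b → injective-≗ (λ a → table-≗ a b) (injectiveʳ b)) a b)
  where
  open IsLoop loop

  values : 𝔽₄ → 𝔽₄ → 𝔽₄
  -- The first entry is `a` in place of `a ∙ 𝟘`, as the enumerated tables have the identity law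
  -- built in.
  values a = fromValues a (a ∙ 𝟙) (a ∙ ω) (a ∙ ω²)

  values-≗ : ∀ a → values a ≗ (a ∙_)
  values-≗ a 𝟘  = sym (identityʳ a)
  values-≗ a 𝟙  = refl
  values-≗ a ω  = refl
  values-≗ a ω² = refl

  table = fromRows (values 𝟙) (values ω) (values ω²)

  table-≗ : ∀ a → table a ≗ (a ∙_)
  table-≗ 𝟘  b = sym (identityˡ b)
  table-≗ 𝟙  b = values-≗ 𝟙 b
  table-≗ ω  b = values-≗ ω b
  table-≗ ω² b = values-≗ ω² b

  row : ∀ a → Injective (values a)
  row a = injective-≗ (values-≗ a) (injectiveˡ a)

-- Translations and scalings of 𝔽₄.

+-involutive : ∀ a b → a + (a + b) ≡ b
+-involutive a b = trans (sym (+-assoc a a b)) (cong (_+ b) (-‿inverseʳ a))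

translation : 𝔽₄ → 𝔽₄ ↔ 𝔽₄
translation a = mk↔ₛ′ (a +_) (a +_) (+-involutive a) (+-involutive a)

scaling : ∀ u → u ≢ 𝟘 → 𝔽₄ ↔ 𝔽₄
-- For nonzero u, the inverse of u is u².
scaling u u≢𝟘 = mk↔ₛ′ (u *_) (u * u *_) (λ a → proj₁ (inverse u u≢𝟘 a)) (λ a → proj₂ (inverse u u≢𝟘 a))
  where
  inverse : ∀ u → u ≢ 𝟘 → ∀ a → (u * (u * u * a) ≡ a) × (u * u * (u * a) ≡ a)
  inverse = from-yes (all? λ u → ¬? (u ≟ 𝟘) →-dec all? λ a →
    (u * (u * u * a) ≟ a) ×-dec (u * u * (u * a) ≟ a))

-- Normalising a Latin square to a loop.

module LatinSquare (F : 𝔽₄ → 𝔽₄ → 𝔽₄)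
  (permutes : ∀ a → IsPermutation (λ x → F x a) × IsPermutation (F a)) where
  open ≡-Reasoning

  private
    e = F 𝟘 𝟘

  normalise₁ normalise₂ : 𝔽₄ ↔ 𝔽₄
  normalise₁ = ↔-trans (⤖⇒↔ (mk⤖ (proj₁ (permutes 𝟘)))) (translation e)
  normalise₂ = ↔-trans (⤖⇒↔ (mk⤖ (proj₂ (permutes 𝟘)))) (translation e)

  _∙_ : 𝔽₄ → 𝔽₄ → 𝔽₄
  a ∙ b = e + F (from normalise₁ a) (from normalise₂ b)

  -- This exhibits the isotopism from `F` to `_∙_`, with translation by `e` acting on values.
  ∙-normalise : ∀ x y → to normalise₁ x ∙ to normalise₂ y ≡ e + F x y
  ∙-normalise x y = cong (e +_) (cong₂ F (strictlyInverseʳ normalise₁ x) (strictlyInverseʳ normalise₂ y))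

  -- Both normalisations send `𝟘` to `e + F 𝟘 𝟘`, that is `e + e`, which vanishes in characteristic
  -- 2.
  from-𝟘 : ∀ (h : 𝔽₄ ↔ 𝔽₄) → to h 𝟘 ≡ e + e → from h 𝟘 ≡ 𝟘
  from-𝟘 h h𝟘≡e+e = trans (cong (from h) (sym (trans h𝟘≡e+e (-‿inverseʳ e)))) (strictlyInverseʳ h 𝟘)

  ∙-isLoop : IsLoop _∙_
  ∙-isLoop = record
    -- With first argument `𝟘`, the operation is `normalise₂` applied after its own inverse.
    { identityˡ  = λ b → trans
        (cong (λ x → e + F x (from normalise₂ b)) (from-𝟘 normalise₁ refl)) (strictlyInverseˡ normalise₂ b)
    ; identityʳ  = λ a → trans
        (cong (λ y → e + F (from normalise₁ a) y) (from-𝟘 normalise₂ refl)) (strictlyInverseˡ normalise₁ a)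
    ; injectiveˡ = λ a b c eq → from-injective normalise₂ b c
        (proj₁ (proj₂ (permutes (from normalise₁ a))) (+-cancelˡ e _ _ eq))
    ; injectiveʳ = λ b a c eq → from-injective normalise₁ a c
        (proj₁ (proj₁ (permutes (from normalise₂ b))) (+-cancelˡ e _ _ eq))
    }
    where
    from-injective : ∀ (h : 𝔽₄ ↔ 𝔽₄) → Injective (from h)
    from-injective h a b eq = trans (sym (strictlyInverseˡ h a)) (trans (cong (to h) eq) (strictlyInverseˡ h b))

  parameter≡𝟘⇒separable : (∀ a b → a ∙ b ≡ twist 𝟘 a b) → ∀ x y → F x y ≡ F x 𝟘 + (e + F 𝟘 y)
  parameter≡𝟘⇒separable ∙≗twist x y = begin
    F x y                                     ≡⟨ +-involutive e (F x y) ⟨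
    e + (e + F x y)                           ≡⟨ cong (e +_) (∙-normalise x y) ⟨
    e + (to normalise₁ x ∙ to normalise₂ y)   ≡⟨ cong (e +_) (∙≗twist (to normalise₁ x) (to normalise₂ y)) ⟩
    -- At u = 0 the trace term reduces to `𝟘`, and the normalisations unfold.
    e + (e + F x 𝟘 + (e + F 𝟘 y) + 𝟘)         ≡⟨ cong (e +_) (+-identityʳ _) ⟩
    e + (e + F x 𝟘 + (e + F 𝟘 y))             ≡⟨ cong (e +_) (+-assoc e (F x 𝟘) (e + F 𝟘 y)) ⟩
    e + (e + (F x 𝟘 + (e + F 𝟘 y)))           ≡⟨ +-involutive e _ ⟩
    F x 𝟘 + (e + F 𝟘 y)                       ∎

  parameter≢𝟘⇒≃ : ∀ u → u ≢ 𝟘 → (∀ a b → a ∙ b ≡ twist u a b) → F ≃ twist 𝟙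
  parameter≢𝟘⇒≃ u u≢𝟘 ∙≗twist = isotopy
    (↔-trans normalise₁ (scaling u u≢𝟘)) (↔-trans normalise₂ (scaling u u≢𝟘)) (↔-trans (translation e) (scaling u u≢𝟘))
    λ x y → begin
      twist 𝟙 (u * to normalise₁ x) (u * to normalise₂ y)  ≡⟨ twist-scale u (to normalise₁ x) (to normalise₂ y) ⟩
      u * twist u (to normalise₁ x) (to normalise₂ y)      ≡⟨ cong (u *_) (∙≗twist (to normalise₁ x) (to normalise₂ y)) ⟨
      u * (to normalise₁ x ∙ to normalise₂ y)              ≡⟨ cong (u *_) (∙-normalise x y) ⟩
      u * (e + F x y)                                      ∎

  separable-or-≃ : (∀ x y → F x y ≡ F x 𝟘 + (e + F 𝟘 y)) ⊎ F ≃ twist 𝟙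
  separable-or-≃ with loop-twist ∙-isLoop
  ... | u , ∙≗twist with u ≟ 𝟘
  ...   | yes refl = inj₁ (parameter≡𝟘⇒separable ∙≗twist)
  ...   | no  u≢𝟘  = inj₂ (parameter≢𝟘⇒≃ u u≢𝟘 ∙≗twist)

-- Reduction of `ℒ𝒫₄,₄` to the class of `twist 𝟙`.

ℒ𝒫₄,₄⇒≃twist : ∀ f → ℒ𝒫₄,₄ f → eval₂ f ≃ twist 𝟙
ℒ𝒫₄,₄⇒≃twist f (permutes , degree) = [ ⊥-elim ∘ not-separable , id ]′ (LatinSquare.separable-or-≃ (eval₂ f) permutes)
  where
  not-separable : ¬ (∀ x y → eval₂ f x y ≡ eval₂ f x 𝟘 + (eval₂ f 𝟘 𝟘 + eval₂ f 𝟘 y))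
  not-separable separable = totalDegree4⇒mixed f degree
    (separable⇒mixed-coeff≡𝟘 f (λ b → eval₂ f 𝟘 𝟘 + eval₂ f 𝟘 b) separable)

theorem4p2 : ∀ f g → ℒ𝒫₄,₄ f → ℒ𝒫₄,₄ g → Isotopic f g
theorem4p2 f g f∈ g∈ = ≃⇒Isotopic f g (≃-trans (ℒ𝒫₄,₄⇒≃twist f f∈) (≃-sym (ℒ𝒫₄,₄⇒≃twist g g∈)))
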